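{- For every positive integer $n$ there exists a set $P_n$ of $n^2$ points in $\mathbb{R}^2$ which can be covered with $n$ lines, such that no subset of $P_n$ of size $\Omega(n^2)$ can be contained in a projective transformation of a rectangular grid of size $o(n^3)$. Explicitly: the sets $P_n$ can be chosen so that for every constant $c>0$ there is a constant $c'>0$ such that, for every $n$, every subset $P'\subseteq P_n$ with $|P'|\geq c\,n^2$, and all positive integers $s,t$, if $P'$ is contained in an $s\times t$ grid, then $st\geq c'n^3$.
   Context: A set of lines covers a point set if every point of the set lies on at least one of the lines. $[k]=\{1,\ldots,k\}$. An $s\times t$ grid is a point set in $\mathbb{R}^2$ of the form $f([t]\times[s])$, where $f$ is an (invertible) projective transformation of the plane that sends all points of $[t]\times[s]$ to points of $\mathbb{R}^2$ (none to infinity). The size of an $s\times t$ grid is $st$. -}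

module Defs where

open import Data.Bool.Base using (if_then_else_)
open import Data.Fin.Base using (Fin; zero; suc)
import Data.Fin.Properties as Fin
open import Data.Fin.Subset using (Subset; _∈_)
open import Data.Integer.Base using (+_)
open import Data.Nat.Base as ℕ using (ℕ; _⊔_)
import Data.Nat.Properties as ℕ
open import Data.Product.Base using (_×_; _,_; ∃-syntax; proj₁; proj₂)
open import Data.Rational.Base as ℚ using (ℚ; 0ℚ; 1ℚ; ½; ∣_∣; 1/_)
import Data.Rational.Properties as ℚ
open import Data.Rational.Literals using (fromℤ)
open import Data.Rational.Solver using (module +-*-Solver)
open import Function.Definitions using (Injective)
open import Relation.Binary.PropositionalEquality
  using (_≡_; refl; sym; cong; cong₂; subst; module ≡-Reasoning)
open import Relation.Nullary using (¬_; does)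
open import Relation.Unary using (_≐_)

-- Real numbers are Cauchy sequences of rationals, compared with _≈_ and
-- never with _≡_.

Cauchy : (ℕ → ℚ) → Set
Cauchy x = ∀ ε → 0ℚ ℚ.< ε →
  ∃[ N ] ∀ m n → N ℕ.≤ m → N ℕ.≤ n → ∣ x m ℚ.- x n ∣ ℚ.< ε

record ℝ : Set where
  constructor mkℝ
  field
    seq    : ℕ → ℚ
    cauchy : Cauchy seq

open ℝ public

infix 4 _≈_ _≉_ _<_ _≤_
infixl 6 _+_
infixl 7 _*_

-- A record rather than a function, so that x and y can be inferred.
record _≈_ (x y : ℝ) : Set where
  constructor mk≈
  field
    close : ∀ ε → 0ℚ ℚ.< ε →
      ∃[ N ] ∀ n → N ℕ.≤ n → ∣ seq x n ℚ.- seq y n ∣ ℚ.< ε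

open _≈_ public

_≉_ : ℝ → ℝ → Set
x ≉ y = ¬ x ≈ y

-- A gap ε independent of n is needed: termwise strict inequality would
-- make 0 < lim 1/n.
_<_ : ℝ → ℝ → Set
x < y = ∃[ ε ] 0ℚ ℚ.< ε × ∃[ N ] ∀ n → N ℕ.≤ n → seq x n ℚ.+ ε ℚ.≤ seq y n

_≤_ : ℝ → ℝ → Set
x ≤ y = ¬ y < x

fromℚ : ℚ → ℝ
fromℚ q = mkℝ (λ _ → q) λ ε 0<ε →
  0 , λ _ _ _ _ → subst (λ r → ∣ r ∣ ℚ.< ε) (sym (ℚ.+-inverseʳ q)) 0<ε

fromℕ : ℕ → ℝ
fromℕ n = fromℚ (fromℤ (+ n))

0ℝ 1ℝ : ℝ
0ℝ = fromℕ 0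
1ℝ = fromℕ 1

private
  ε*½-pos : ∀ {ε} → 0ℚ ℚ.< ε → 0ℚ ℚ.< ε ℚ.* ½
  ε*½-pos {ε} 0<ε = ℚ.*-monoˡ-<-pos ½ 0<ε

  ε*½+ε*½ : ∀ ε → ε ℚ.* ½ ℚ.+ ε ℚ.* ½ ≡ ε
  ε*½+ε*½ = solve 1 (λ e → e :* con ½ :+ e :* con ½ := e) refl
    where open +-*-Solver

  diff-+ : ∀ a b c d →
           (a ℚ.+ b) ℚ.- (c ℚ.+ d) ≡ (a ℚ.- c) ℚ.+ (b ℚ.- d)
  diff-+ = solve 4 (λ a b c d →
    (a :+ b) :- (c :+ d) := (a :- c) :+ (b :- d)) refl
    where open +-*-Solver

  diff-* : ∀ a b c d →
           a ℚ.* b ℚ.- c ℚ.* d ≡ a ℚ.* (b ℚ.- d) ℚ.+ d ℚ.* (a ℚ.- c)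
  diff-* = solve 4 (λ a b c d →
    a :* b :- c :* d := a :* (b :- d) :+ d :* (a :- c)) refl
    where open +-*-Solver

  cancel : ∀ a b → (a ℚ.- b) ℚ.+ b ≡ a
  cancel = solve 2 (λ a b → (a :- b) :+ b := a) refl
    where open +-*-Solver

  Bounded : (ℕ → ℚ) → Set
  Bounded x = ∃[ N ] ∃[ B ] ∀ n → N ℕ.≤ n → ∣ x n ∣ ℚ.< B

  bounded : ∀ {x} → Cauchy x → Bounded x
  bounded {x} cx with cx 1ℚ (ℚ.positive⁻¹ 1ℚ)
  ... | N , near = N , 1ℚ ℚ.+ ∣ x N ∣ , λ n N≤n → begin-strict
    ∣ x n ∣                       ≡⟨ cong ∣_∣ (cancel (x n) (x N)) ⟨
    ∣ (x n ℚ.- x N) ℚ.+ x N ∣     ≤⟨ ℚ.∣p+q∣≤∣p∣+∣q∣ (x n ℚ.- x N) (x N) ⟩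
    ∣ x n ℚ.- x N ∣ ℚ.+ ∣ x N ∣   <⟨ ℚ.+-monoˡ-< ∣ x N ∣ (near n N N≤n ℕ.≤-refl) ⟩
    1ℚ ℚ.+ ∣ x N ∣                ∎
    where open ℚ.≤-Reasoning

  scale : ∀ K ε → 0ℚ ℚ.< K → 0ℚ ℚ.< ε → ∃[ δ ] 0ℚ ℚ.< δ × K ℚ.* δ ≡ ε
  scale K ε 0<K 0<ε = 1/ K ℚ.* ε , ℚ.positive⁻¹ (1/ K ℚ.* ε) , (begin
    K ℚ.* (1/ K ℚ.* ε)   ≡⟨ ℚ.*-assoc K (1/ K) ε ⟨
    K ℚ.* 1/ K ℚ.* ε     ≡⟨ cong (ℚ._* ε) (ℚ.*-inverseʳ K) ⟩
    1ℚ ℚ.* ε             ≡⟨ ℚ.*-identityˡ ε ⟩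
    ε                    ∎)
    where
    open ≡-Reasoning
    instance
      K-pos : ℚ.Positive K
      K-pos = ℚ.positive 0<K
      K-nonZero : ℚ.NonZero K
      K-nonZero = ℚ.pos⇒nonZero K
      product-pos : ℚ.Positive (1/ K ℚ.* ε)
      product-pos = ℚ.pos*pos⇒pos (1/ K) {{ℚ.1/pos⇒pos K}} ε {{ℚ.positive 0<ε}}

  product-close : ∀ A B δ {ε} a b c d → (A ℚ.+ B) ℚ.* δ ≡ ε → 0ℚ ℚ.< δ →
    ∣ a ∣ ℚ.< A → ∣ d ∣ ℚ.< B →
    ∣ a ℚ.- c ∣ ℚ.< δ → ∣ b ℚ.- d ∣ ℚ.< δ →
    ∣ a ℚ.* b ℚ.- c ℚ.* d ∣ ℚ.< ε
  product-close A B δ {ε} a b c d K*δ≡ε 0<δ a<A d<B a-c<δ b-d<δ = begin-strict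
    ∣ a ℚ.* b ℚ.- c ℚ.* d ∣
      ≡⟨ cong ∣_∣ (diff-* a b c d) ⟩
    ∣ a ℚ.* (b ℚ.- d) ℚ.+ d ℚ.* (a ℚ.- c) ∣
      ≤⟨ ℚ.∣p+q∣≤∣p∣+∣q∣ (a ℚ.* (b ℚ.- d)) (d ℚ.* (a ℚ.- c)) ⟩
    ∣ a ℚ.* (b ℚ.- d) ∣ ℚ.+ ∣ d ℚ.* (a ℚ.- c) ∣
      ≡⟨ cong₂ ℚ._+_ (ℚ.∣p*q∣≡∣p∣*∣q∣ a (b ℚ.- d)) (ℚ.∣p*q∣≡∣p∣*∣q∣ d (a ℚ.- c)) ⟩
    ∣ a ∣ ℚ.* ∣ b ℚ.- d ∣ ℚ.+ ∣ d ∣ ℚ.* ∣ a ℚ.- c ∣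
      ≤⟨ ℚ.+-mono-≤
           (ℚ.*-monoˡ-≤-nonNeg ∣ a ∣ {{ℚ.∣-∣-nonNeg a}} (ℚ.<⇒≤ b-d<δ))
           (ℚ.*-monoˡ-≤-nonNeg ∣ d ∣ {{ℚ.∣-∣-nonNeg d}} (ℚ.<⇒≤ a-c<δ)) ⟩
    ∣ a ∣ ℚ.* δ ℚ.+ ∣ d ∣ ℚ.* δ
      ≡⟨ ℚ.*-distribʳ-+ δ ∣ a ∣ ∣ d ∣ ⟨
    (∣ a ∣ ℚ.+ ∣ d ∣) ℚ.* δ
      <⟨ ℚ.*-monoˡ-<-pos δ {{ℚ.positive 0<δ}} (ℚ.+-mono-< a<A d<B) ⟩
    (A ℚ.+ B) ℚ.* δ
      ≡⟨ K*δ≡ε ⟩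
    ε ∎
    where open ℚ.≤-Reasoning

-- Opaque because unfolding these proofs makes type checking very slow.
opaque
  +-cauchy : ∀ {x y} → Cauchy x → Cauchy y → Cauchy (λ n → x n ℚ.+ y n)
  +-cauchy {x} {y} cx cy ε 0<ε
    with cx (ε ℚ.* ½) (ε*½-pos 0<ε) | cy (ε ℚ.* ½) (ε*½-pos 0<ε)
  ... | M , closeˣ | N , closeʸ = M ⊔ N , λ m n p q → begin-strict
    ∣ (x m ℚ.+ y m) ℚ.- (x n ℚ.+ y n) ∣
      ≡⟨ cong ∣_∣ (diff-+ (x m) (y m) (x n) (y n)) ⟩
    ∣ (x m ℚ.- x n) ℚ.+ (y m ℚ.- y n) ∣
      ≤⟨ ℚ.∣p+q∣≤∣p∣+∣q∣ (x m ℚ.- x n) (y m ℚ.- y n) ⟩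
    ∣ x m ℚ.- x n ∣ ℚ.+ ∣ y m ℚ.- y n ∣
      <⟨ ℚ.+-mono-< (closeˣ m n (ℕ.m⊔n≤o⇒m≤o M N p) (ℕ.m⊔n≤o⇒m≤o M N q))
                    (closeʸ m n (ℕ.m⊔n≤o⇒n≤o M N p) (ℕ.m⊔n≤o⇒n≤o M N q)) ⟩
    ε ℚ.* ½ ℚ.+ ε ℚ.* ½
      ≡⟨ ε*½+ε*½ ε ⟩
    ε ∎
    where open ℚ.≤-Reasoning

  *-cauchy : ∀ {x y} → Cauchy x → Cauchy y → Cauchy (λ n → x n ℚ.* y n)
  *-cauchy {x} {y} cx cy ε 0<ε = step (bounded {x} cx) (bounded {y} cy)
    where
    Goal : Set
    Goal = ∃[ N ] ∀ m n → N ℕ.≤ m → N ℕ.≤ n →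
      ∣ x m ℚ.* y m ℚ.- x n ℚ.* y n ∣ ℚ.< ε

    step : Bounded x → Bounded y → Goal
    step (K , A , boundˣ) (L , B , boundʸ) = choose (scale (A ℚ.+ B) ε 0<A+B 0<ε)
      where
      0<A+B : 0ℚ ℚ.< A ℚ.+ B
      0<A+B = ℚ.+-mono-< {0ℚ} {A} {0ℚ} {B}
        (ℚ.≤-<-trans (ℚ.0≤∣p∣ (x K)) (boundˣ K ℕ.≤-refl))
        (ℚ.≤-<-trans (ℚ.0≤∣p∣ (y L)) (boundʸ L ℕ.≤-refl))

      choose : ∃[ δ ] 0ℚ ℚ.< δ × (A ℚ.+ B) ℚ.* δ ≡ ε → Goal
      choose (δ , 0<δ , [A+B]*δ≡ε) = combine (cx δ 0<δ) (cy δ 0<δ)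
        where
        combine : (∃[ M ] ∀ m n → M ℕ.≤ m → M ℕ.≤ n → ∣ x m ℚ.- x n ∣ ℚ.< δ) →
                  (∃[ N ] ∀ m n → N ℕ.≤ m → N ℕ.≤ n → ∣ y m ℚ.- y n ∣ ℚ.< δ) →
                  Goal
        combine (M , closeˣ) (N , closeʸ) = K ⊔ L ⊔ (M ⊔ N) , λ m n p q →
          let K⊔L≤m = ℕ.m⊔n≤o⇒m≤o (K ⊔ L) (M ⊔ N) p
              K⊔L≤n = ℕ.m⊔n≤o⇒m≤o (K ⊔ L) (M ⊔ N) q
              M⊔N≤m = ℕ.m⊔n≤o⇒n≤o (K ⊔ L) (M ⊔ N) p
              M⊔N≤n = ℕ.m⊔n≤o⇒n≤o (K ⊔ L) (M ⊔ N) q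
          in product-close A B δ (x m) (y m) (x n) (y n) [A+B]*δ≡ε 0<δ
               (boundˣ m (ℕ.m⊔n≤o⇒m≤o K L K⊔L≤m))
               (boundʸ n (ℕ.m⊔n≤o⇒n≤o K L K⊔L≤n))
               (closeˣ m n (ℕ.m⊔n≤o⇒m≤o M N M⊔N≤m) (ℕ.m⊔n≤o⇒m≤o M N M⊔N≤n))
               (closeʸ m n (ℕ.m⊔n≤o⇒n≤o M N M⊔N≤m) (ℕ.m⊔n≤o⇒n≤o M N M⊔N≤n))

_+_ : ℝ → ℝ → ℝ
x + y = mkℝ (λ n → seq x n ℚ.+ seq y n)
  (+-cauchy {seq x} {seq y} (cauchy x) (cauchy y))

_*_ : ℝ → ℝ → ℝ
x * y = mkℝ (λ n → seq x n ℚ.* seq y n)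
  (*-cauchy {seq x} {seq y} (cauchy x) (cauchy y))

ℝ² : Set
ℝ² = ℝ × ℝ

infix 4 _≈²_ _on_ _∈ᴳ_

_≈²_ : ℝ² → ℝ² → Set
(x , y) ≈² (x′ , y′) = x ≈ x′ × y ≈ y′

-- A set of exactly k points, enumerated without repetition.
record PointSet (k : ℕ) : Set where
  field
    point    : Fin k → ℝ²
    distinct : Injective _≡_ _≈²_ point

open PointSet public

record Line : Set where
  field
    a b c         : ℝ
    nondegenerate : ¬ (a ≈ 0ℝ × b ≈ 0ℝ)

_on_ : ℝ² → Line → Set
(x , y) on ℓ = a * x + b * y ≈ c
  where open Line ℓ

-- A set of exactly k lines; two lines are equal when they have the same
-- points.
record LineSet (k : ℕ) : Set where
  field
    line     : Fin k → Line
    distinct : Injective _≡_ (λ ℓ ℓ′ → (_on ℓ) ≐ (_on ℓ′)) line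

open LineSet public using (line)

_Covers_ : ∀ {k m} → LineSet k → PointSet m → Set
L Covers P = ∀ i → ∃[ j ] point P i on line L j

-- Projective transformations are invertible matrices acting on homogeneous
-- coordinates; (x , y) has coordinates (x : y : 1), and the points at
-- infinity are those with last coordinate 0.
ℝ³ : Set
ℝ³ = Fin 3 → ℝ

Matrix : Set
Matrix = Fin 3 → Fin 3 → ℝ

Σ₃ : (Fin 3 → ℝ) → ℝ
Σ₃ f = f zero + f (suc zero) + f (suc (suc zero))

_·_ : Matrix → ℝ³ → ℝ³
(A · v) i = Σ₃ λ j → A i j * v j

_⊗_ : Matrix → Matrix → Matrix
(A ⊗ B) i k = Σ₃ λ j → A i j * B j k

I₃ : Matrix
I₃ i j = if does (i Fin.≟ j) then 1ℝ else 0ℝ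

_≈ᴹ_ : Matrix → Matrix → Set
A ≈ᴹ B = ∀ i j → A i j ≈ B i j

record ProjectiveTransformation : Set where
  field
    matrix   : Matrix
    inverse  : Matrix
    inverseˡ : (inverse ⊗ matrix) ≈ᴹ I₃
    inverseʳ : (matrix ⊗ inverse) ≈ᴹ I₃

open ProjectiveTransformation public using (matrix)

homogeneous : ℝ² → ℝ³
homogeneous (x , y) zero             = x
homogeneous (x , y) (suc zero)       = y
homogeneous (x , y) (suc (suc zero)) = 1ℝ

-- Equality of points of the projective plane: u and v are proportional.
_∼_ : ℝ³ → ℝ³ → Set
u ∼ v = ∃[ r ] r ≉ 0ℝ × (∀ i → u i ≈ r * v i)

_⟨_⟩ : ProjectiveTransformation → ℝ² → ℝ³
f ⟨ p ⟩ = matrix f · homogeneous p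

AtInfinity : ℝ³ → Set
AtInfinity v = v (suc (suc zero)) ≈ 0ℝ

infix 4 _∈[_]

_∈[_] : ℕ → ℕ → Set
a ∈[ k ] = 1 ℕ.≤ a × a ℕ.≤ k

latticePoint : ℕ → ℕ → ℝ²
latticePoint a b = fromℕ a , fromℕ b

-- An s × t grid is the image of [t] × [s], in this order.
record Grid (s t : ℕ) : Set where
  field
    transformation : ProjectiveTransformation
    finite         : ∀ a b → a ∈[ t ] → b ∈[ s ] →
                     ¬ AtInfinity (transformation ⟨ latticePoint a b ⟩)

_∈ᴳ_ : ∀ {s t} → ℝ² → Grid s t → Set
_∈ᴳ_ {s} {t} p G = ∃[ a ] ∃[ b ] a ∈[ t ] × b ∈[ s ] ×
  (Grid.transformation G ⟨ latticePoint a b ⟩) ∼ homogeneous p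

-- A subset of an enumerated point set is a set of indices.
_↾_⊆ᴳ_ : ∀ {k s t} → PointSet k → Subset k → Grid s t → Set
P ↾ S ⊆ᴳ G = ∀ i → i ∈ S → point P i ∈ᴳ G

module Submission where

-- The points are (Bʲ , i) with 0 ≤ i, j < n and B = 1 + n⁶, which lie on n
-- horizontal lines.  Suppose a grid of size less than n³ contains at least four
-- of them on one row, with abscissas x₁ < x₂ < x₃ < x₄.  The cross-ratio
--   (x₁ − x₄)(x₂ − x₃) / (x₁ − x₂)(x₃ − x₄) ≥ n⁶
-- is a projective invariant, hence equals the same expression in the
-- first or in the second coordinates of four lattice points of [1, n³)², which
-- is less than n⁶.  So a subset inside such a grid has at most 3n points, and this
-- can only reach cn² when n ≤ 3/c.

open import Defs
open import Data.Nat.Base as ℕ using (ℕ; NonZero; _^_)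
open import Data.Product.Base using (Σ-syntax; ∃-syntax; _×_)
open import Data.Fin.Subset using (Subset; ∣_∣)

open import Data.Bool.Base using (true; false)
open import Data.Fin.Base as Fin using (Fin; zero; suc; toℕ; combine; remQuot; inject≤)
open import Data.Fin.Patterns
import Data.Fin.Properties as Fin
open import Data.Fin.Subset using (_∈_)
open import Data.Integer.Base as ℤ using (ℤ; +_; _⊖_)
import Data.Integer.Properties as ℤ
open import Data.Nat.Base using (zero; suc; z≤n; s≤s; _⊔_; ∣_-_∣)
import Data.Nat.Properties as ℕ
open import Data.Product.Base using (_,_; proj₁; proj₂; uncurry)
open import Data.Rational.Base as ℚ using (ℚ; 0ℚ; 1ℚ; ½; mkℚ)
open import Data.Rational.Literals using (fromℤ)
import Data.Rational.Properties as ℚ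
open import Data.Rational.Solver using (module +-*-Solver)
import Data.Rational.Unnormalised.Base as ℚᵘ
import Data.Rational.Unnormalised.Properties as ℚᵘ
open import Data.Sum.Base using (inj₁; inj₂)
open import Data.Vec.Base using (Vec; []; _∷_; _++_; concat; lookup; group)
open import Data.Vec.Properties using (lookup⇒[]=; lookup-concat)
open import Level using (0ℓ)
open import Relation.Binary.Bundles using (Setoid)
open import Relation.Binary.Definitions using (tri<; tri≈; tri>)
open import Relation.Binary.PropositionalEquality
  using (_≡_; _≢_; refl; sym; trans; cong; cong₂; subst; subst₂; module ≡-Reasoning)
open import Relation.Nullary using (yes; no; contradiction)
open ProjectiveTransformation using (inverse; inverseˡ)

-- Arithmetic of Cauchy sequences

module _ where
  open ℚ.≤-Reasoning
  open +-*-Solver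

  ½-pos : ∀ {ε} → 0ℚ ℚ.< ε → 0ℚ ℚ.< ε ℚ.* ½
  ½-pos = ℚ.*-monoˡ-<-pos ½

  ∣a+b∣<ε : ∀ {ε} a b → ℚ.∣ a ∣ ℚ.< ε ℚ.* ½ → ℚ.∣ b ∣ ℚ.< ε ℚ.* ½ → ℚ.∣ a ℚ.+ b ∣ ℚ.< ε
  ∣a+b∣<ε {ε} a b a<ε/2 b<ε/2 = begin-strict
    ℚ.∣ a ℚ.+ b ∣           ≤⟨ ℚ.∣p+q∣≤∣p∣+∣q∣ a b ⟩
    ℚ.∣ a ∣ ℚ.+ ℚ.∣ b ∣     <⟨ ℚ.+-mono-< a<ε/2 b<ε/2 ⟩
    ε ℚ.* ½ ℚ.+ ε ℚ.* ½     ≡⟨ solve 1 (λ e → e :* con ½ :+ e :* con ½ := e) refl ε ⟩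
    ε                       ∎

  cauchy-bounded : ∀ x → Cauchy x → ∃[ N ] ∃[ B ] 0ℚ ℚ.< B × (∀ n → N ℕ.≤ n → ℚ.∣ x n ∣ ℚ.≤ B)
  cauchy-bounded x cx with cx 1ℚ (ℚ.positive⁻¹ 1ℚ)
  ... | N , near = N , 1ℚ ℚ.+ ℚ.∣ x N ∣ , ℚ.+-mono-<-≤ (ℚ.positive⁻¹ 1ℚ) (ℚ.0≤∣p∣ (x N)) ,
    λ n N≤n → begin
      ℚ.∣ x n ∣                           ≡⟨ cong ℚ.∣_∣ (solve 2 (λ a b → a := (a :- b) :+ b) refl (x n) (x N)) ⟩
      ℚ.∣ (x n ℚ.- x N) ℚ.+ x N ∣         ≤⟨ ℚ.∣p+q∣≤∣p∣+∣q∣ (x n ℚ.- x N) (x N) ⟩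
      ℚ.∣ x n ℚ.- x N ∣ ℚ.+ ℚ.∣ x N ∣     ≤⟨ ℚ.+-monoˡ-≤ ℚ.∣ x N ∣ (ℚ.<⇒≤ (near n N N≤n ℕ.≤-refl)) ⟩
      1ℚ ℚ.+ ℚ.∣ x N ∣                    ∎

  pointwise : ∀ {x y} → (∀ n → seq x n ≡ seq y n) → x ≈ y
  close (pointwise {x} {y} x≡y) ε 0<ε = 0 , λ n _ →
    subst (ℚ._< ε) (sym (cong ℚ.∣_∣ (trans (cong (ℚ._- seq y n) (x≡y n)) (ℚ.+-inverseʳ (seq y n))))) 0<ε

  ≈-refl : ∀ {x} → x ≈ x
  ≈-refl = pointwise λ _ → refl

  ≈-sym : ∀ {x y} → x ≈ y → y ≈ x
  close (≈-sym {x} {y} x≈y) ε 0<ε with close x≈y ε 0<ε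
  ... | N , near = N , λ n N≤n → subst (ℚ._< ε)
    (trans (sym (ℚ.∣-p∣≡∣p∣ (seq x n ℚ.- seq y n)))
      (cong ℚ.∣_∣ (solve 2 (λ a b → :- (a :- b) := b :- a) refl (seq x n) (seq y n))))
    (near n N≤n)

  ≈-trans : ∀ {x y z} → x ≈ y → y ≈ z → x ≈ z
  close (≈-trans {x} {y} {z} x≈y y≈z) ε 0<ε
    with close x≈y (ε ℚ.* ½) (½-pos 0<ε) | close y≈z (ε ℚ.* ½) (½-pos 0<ε)
  ... | M , nearˣ | N , nearʸ = M ⊔ N , λ n p →
    subst (λ q → ℚ.∣ q ∣ ℚ.< ε)
      (solve 3 (λ a b c → (a :- b) :+ (b :- c) := a :- c) refl (seq x n) (seq y n) (seq z n))
      (∣a+b∣<ε (seq x n ℚ.- seq y n) (seq y n ℚ.- seq z n)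
        (nearˣ n (ℕ.m⊔n≤o⇒m≤o M N p)) (nearʸ n (ℕ.m⊔n≤o⇒n≤o M N p)))

  +-cong : ∀ {x x′ y y′} → x ≈ x′ → y ≈ y′ → x + y ≈ x′ + y′
  close (+-cong {x} {x′} {y} {y′} x≈x′ y≈y′) ε 0<ε
    with close x≈x′ (ε ℚ.* ½) (½-pos 0<ε) | close y≈y′ (ε ℚ.* ½) (½-pos 0<ε)
  ... | M , nearˣ | N , nearʸ = M ⊔ N , λ n p →
    subst (λ q → ℚ.∣ q ∣ ℚ.< ε)
      (solve 4 (λ a b c d → (a :- b) :+ (c :- d) := (a :+ c) :- (b :+ d)) refl
        (seq x n) (seq x′ n) (seq y n) (seq y′ n))
      (∣a+b∣<ε (seq x n ℚ.- seq x′ n) (seq y n ℚ.- seq y′ n)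
        (nearˣ n (ℕ.m⊔n≤o⇒m≤o M N p)) (nearʸ n (ℕ.m⊔n≤o⇒n≤o M N p)))

  ∣*∣-< : ∀ B δ {ε} z w → δ ℚ.* B ≡ ε → 0ℚ ℚ.< B → ℚ.∣ z ∣ ℚ.< δ → ℚ.∣ w ∣ ℚ.≤ B → ℚ.∣ z ℚ.* w ∣ ℚ.< ε
  ∣*∣-< B δ {ε} z w δB≡ε 0<B z<δ w≤B = begin-strict
    ℚ.∣ z ℚ.* w ∣          ≡⟨ ℚ.∣p*q∣≡∣p∣*∣q∣ z w ⟩
    ℚ.∣ z ∣ ℚ.* ℚ.∣ w ∣    ≤⟨ ℚ.*-monoˡ-≤-nonNeg ℚ.∣ z ∣ {{ℚ.∣-∣-nonNeg z}} w≤B ⟩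
    ℚ.∣ z ∣ ℚ.* B          <⟨ ℚ.*-monoˡ-<-pos B {{ℚ.positive 0<B}} z<δ ⟩
    δ ℚ.* B                ≡⟨ δB≡ε ⟩
    ε                      ∎

  divide : ∀ B ε → 0ℚ ℚ.< B → 0ℚ ℚ.< ε → ∃[ δ ] 0ℚ ℚ.< δ × δ ℚ.* B ≡ ε
  divide B ε 0<B 0<ε = ε ℚ.* ℚ.1/ B , ℚ.positive⁻¹ (ε ℚ.* ℚ.1/ B) ,
    trans (ℚ.*-assoc ε (ℚ.1/ B) B) (trans (cong (ε ℚ.*_) (ℚ.*-inverseˡ B)) (ℚ.*-identityʳ ε))
    where
    instance
      B-pos : ℚ.Positive B
      B-pos = ℚ.positive 0<B
      B-nonZero : ℚ.NonZero B
      B-nonZero = ℚ.pos⇒nonZero B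
      product-pos : ℚ.Positive (ε ℚ.* ℚ.1/ B)
      product-pos = ℚ.pos*pos⇒pos ε {{ℚ.positive 0<ε}} (ℚ.1/ B) {{ℚ.1/pos⇒pos B}}

  *-congʳ : ∀ {x x′} y → x ≈ x′ → x * y ≈ x′ * y
  close (*-congʳ {x} {x′} y x≈x′) ε 0<ε =
    -- A tail of `y` is bounded by `B`, so closeness of `x` and `x′` within `δ`, with `δ` times `B`
    -- equal to `ε`, suffices.
    let M , B , 0<B , bound = cauchy-bounded (seq y) (cauchy y)
        δ , 0<δ , δB≡ε      = divide B ε 0<B 0<ε
        N , near            = close x≈x′ δ 0<δ
    in M ⊔ N , λ n p → subst (λ q → ℚ.∣ q ∣ ℚ.< ε)
      (solve 3 (λ a b c → (a :- b) :* c := a :* c :- b :* c) refl (seq x n) (seq x′ n) (seq y n))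
      (∣*∣-< B δ (seq x n ℚ.- seq x′ n) (seq y n) δB≡ε 0<B
        (near n (ℕ.m⊔n≤o⇒n≤o M N p)) (bound n (ℕ.m⊔n≤o⇒m≤o M N p)))

  -- Through _*_ rather than termwise, so that the Cauchy proof comes for free.
  infixl 6 _-ᴿ_
  _-ᴿ_ : ℝ → ℝ → ℝ
  x -ᴿ y = x + fromℚ (ℚ.- 1ℚ) * y

  *-comm : ∀ x y → x * y ≈ y * x
  *-comm x y = pointwise λ n → ℚ.*-comm (seq x n) (seq y n)

  *-cong : ∀ {x x′ y y′} → x ≈ x′ → y ≈ y′ → x * y ≈ x′ * y′
  *-cong {x} {x′} {y} {y′} x≈x′ y≈y′ = ≈-trans (*-congʳ y x≈x′)
    (≈-trans (*-comm x′ y) (≈-trans (*-congʳ x′ y≈y′) (*-comm y′ x′)))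

  -ᴿ-cong : ∀ {x x′ y y′} → x ≈ x′ → y ≈ y′ → x -ᴿ y ≈ x′ -ᴿ y′
  -ᴿ-cong x≈x′ y≈y′ = +-cong x≈x′ (*-cong ≈-refl y≈y′)

ℝ-setoid : Setoid 0ℓ 0ℓ
ℝ-setoid = record
  { Carrier = ℝ ; _≈_ = _≈_
  ; isEquivalence = record { refl = ≈-refl ; sym = ≈-sym ; trans = ≈-trans } }

-- Projective coordinates along a line

module _ where
  open import Relation.Binary.Reasoning.Setoid ℝ-setoid
  open +-*-Solver

  infixl 6 _⊝_
  -- Mirrors `_-ᴿ_` termwise, so that solver identities match the sequences of real differences
  -- exactly.
  _⊝_ : ∀ {n} → Polynomial n → Polynomial n → Polynomial n
  p ⊝ q = p :+ con (ℚ.- 1ℚ) :* q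

  Σ₃-cong : ∀ {f g : Fin 3 → ℝ} → (∀ i → f i ≈ g i) → Σ₃ f ≈ Σ₃ g
  Σ₃-cong f≈g = +-cong (+-cong (f≈g 0F) (f≈g 1F)) (f≈g 2F)

  Σ₃-*ʳ : ∀ (f : Fin 3 → ℝ) z → Σ₃ f * z ≈ Σ₃ (λ i → f i * z)
  Σ₃-*ʳ f z = pointwise λ n → solve 4
    (λ a b c z → (a :+ b :+ c) :* z := a :* z :+ b :* z :+ c :* z) refl
    (seq (f 0F) n) (seq (f 1F) n) (seq (f 2F) n) (seq z n)

  Σ₃-*ˡ : ∀ z (f : Fin 3 → ℝ) → z * Σ₃ f ≈ Σ₃ (λ i → z * f i)
  Σ₃-*ˡ z f = pointwise λ n → solve 4
    (λ a b c z → z :* (a :+ b :+ c) := z :* a :+ z :* b :+ z :* c) refl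
    (seq (f 0F) n) (seq (f 1F) n) (seq (f 2F) n) (seq z n)

  Σ₃-swap : ∀ (f : Fin 3 → Fin 3 → ℝ) → Σ₃ (λ i → Σ₃ (f i)) ≈ Σ₃ (λ j → Σ₃ (λ i → f i j))
  Σ₃-swap f = pointwise λ n → solve 9
    (λ a b c d e f g h i → (a :+ b :+ c) :+ (d :+ e :+ f) :+ (g :+ h :+ i) :=
                           (a :+ d :+ g) :+ (b :+ e :+ h) :+ (c :+ f :+ i)) refl
    (seq (f 0F 0F) n) (seq (f 0F 1F) n) (seq (f 0F 2F) n)
    (seq (f 1F 0F) n) (seq (f 1F 1F) n) (seq (f 1F 2F) n)
    (seq (f 2F 0F) n) (seq (f 2F 1F) n) (seq (f 2F 2F) n)

  *-assoc : ∀ x y z → x * y * z ≈ x * (y * z)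
  *-assoc x y z = pointwise λ n → ℚ.*-assoc (seq x n) (seq y n) (seq z n)

  ·-assoc : ∀ A B v i → ((A ⊗ B) · v) i ≈ (A · (B · v)) i
  ·-assoc A B v i = begin
    Σ₃ (λ k → Σ₃ (λ j → A i j * B j k) * v k)    ≈⟨ Σ₃-cong (λ k → Σ₃-*ʳ (λ j → A i j * B j k) (v k)) ⟩
    Σ₃ (λ k → Σ₃ (λ j → A i j * B j k * v k))    ≈⟨ Σ₃-swap (λ k j → A i j * B j k * v k) ⟩
    Σ₃ (λ j → Σ₃ (λ k → A i j * B j k * v k))    ≈⟨ Σ₃-cong (λ j → Σ₃-cong λ k → *-assoc (A i j) (B j k) (v k)) ⟩
    Σ₃ (λ j → Σ₃ (λ k → A i j * (B j k * v k)))  ≈⟨ Σ₃-cong (λ j → Σ₃-*ˡ (A i j) (λ k → B j k * v k)) ⟨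
    Σ₃ (λ j → A i j * Σ₃ (λ k → B j k * v k))    ∎

  I₃-· : ∀ v i → (I₃ · v) i ≈ v i
  I₃-· v 0F = pointwise λ n → solve 3 (λ a b c → con 1ℚ :* a :+ con 0ℚ :* b :+ con 0ℚ :* c := a)
    refl (seq (v 0F) n) (seq (v 1F) n) (seq (v 2F) n)
  I₃-· v 1F = pointwise λ n → solve 3 (λ a b c → con 0ℚ :* a :+ con 1ℚ :* b :+ con 0ℚ :* c := b)
    refl (seq (v 0F) n) (seq (v 1F) n) (seq (v 2F) n)
  I₃-· v 2F = pointwise λ n → solve 3 (λ a b c → con 0ℚ :* a :+ con 0ℚ :* b :+ con 1ℚ :* c := c)
    refl (seq (v 0F) n) (seq (v 1F) n) (seq (v 2F) n)

  inverse-· : ∀ f v i → (inverse f · (matrix f · v)) i ≈ v i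
  inverse-· f v i = begin
    (inverse f · (matrix f · v)) i  ≈⟨ ·-assoc (inverse f) (matrix f) v i ⟨
    ((inverse f ⊗ matrix f) · v) i  ≈⟨ Σ₃-cong (λ j → *-cong (inverseˡ f i j) (≈-refl {v j})) ⟩
    (I₃ · v) i                      ≈⟨ I₃-· v i ⟩
    v i                             ∎

  -- Apply the inverse matrix to both sides. For fixed `y` the result is affine in `x` up to the
  -- common factor `r`; coordinate `2F` of the left side is `1ℝ` and supplies the denominator of a
  -- fractional linear map.
  preimage : ∀ f l x y r → (∀ i → (f ⟨ l ⟩) i ≈ r * homogeneous (x , y) i) → ∀ i →
    homogeneous l i ≈ r * (x * inverse f i 0F + (y * inverse f i 1F + inverse f i 2F))
  preimage f l x y r f⟨l⟩≈rp i = begin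
    homogeneous l i
      ≈⟨ inverse-· f (homogeneous l) i ⟨
    Σ₃ (λ j → inverse f i j * (f ⟨ l ⟩) j)
      ≈⟨ Σ₃-cong (λ j → *-cong (≈-refl {inverse f i j}) (f⟨l⟩≈rp j)) ⟩
    Σ₃ (λ j → inverse f i j * (r * homogeneous (x , y) j))
      ≈⟨ (pointwise λ n → solve 6
            (λ a b c r x y → a :* (r :* x) :+ b :* (r :* y) :+ c :* (r :* con 1ℚ)
                          := r :* (x :* a :+ (y :* b :+ c))) refl
            (seq (inverse f i 0F) n) (seq (inverse f i 1F) n) (seq (inverse f i 2F) n)
            (seq r n) (seq x n) (seq y n)) ⟩
    r * (x * inverse f i 0F + (y * inverse f i 1F + inverse f i 2F))
      ∎

  -- The map x ↦ (xu + v) / (xp + q), with determinant γ; scale stands for 1 / (xp + q).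
  module Fractional (u v p q : ℝ) where

    record Image (x z : ℝ) : Set where
      constructor image
      field
        scale       : ℝ
        numerator   : z  ≈ scale * (x * u + v)
        denominator : 1ℝ ≈ scale * (x * p + q)
    open Image public

    γ : ℝ
    γ = u * q -ᴿ p * v

    difference : ∀ {x z x′ z′} (i : Image x z) (i′ : Image x′ z′) →
                 z -ᴿ z′ ≈ scale i * scale i′ * ((x -ᴿ x′) * γ)
    difference {x} {z} {x′} {z′} (image r z≈ 1≈) (image r′ z′≈ 1≈′) = begin
      z -ᴿ z′
        -- Each factor 1 becomes the scaled denominator of the other point. The difference is then a
        -- two by two determinant, which factors through `γ` without any division.
        ≈⟨ (pointwise λ n → solve 2 (λ z z′ → z ⊝ z′ := z :* con 1ℚ ⊝ con 1ℚ :* z′) refl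
              (seq z n) (seq z′ n)) ⟩
      z * 1ℝ -ᴿ 1ℝ * z′
        ≈⟨ -ᴿ-cong (*-cong z≈ 1≈′) (*-cong 1≈ z′≈) ⟩
      r * (x * u + v) * (r′ * (x′ * p + q)) -ᴿ r * (x * p + q) * (r′ * (x′ * u + v))
        ≈⟨ (pointwise λ n → solve 8
              (λ u v p q x r x′ r′ →
                r :* (x :* u :+ v) :* (r′ :* (x′ :* p :+ q)) ⊝
                r :* (x :* p :+ q) :* (r′ :* (x′ :* u :+ v))
                := r :* r′ :* ((x ⊝ x′) :* (u :* q ⊝ p :* v))) refl
              (seq u n) (seq v n) (seq p n) (seq q n) (seq x n) (seq r n) (seq x′ n) (seq r′ n)) ⟩
      r * r′ * ((x -ᴿ x′) * γ)
        ∎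

    -- Invariance of the cross-ratio with denominators cleared. By `difference`, both sides contain
    -- each of the four scales once, `γ` twice and the same four differences of the `x`.
    cross-ratio : ∀ {x₁ x₂ x₃ x₄ z₁ z₂ z₃ z₄} →
      Image x₁ z₁ → Image x₂ z₂ → Image x₃ z₃ → Image x₄ z₄ →
      (z₁ -ᴿ z₂) * (z₃ -ᴿ z₄) * ((x₁ -ᴿ x₄) * (x₂ -ᴿ x₃)) ≈
      (z₁ -ᴿ z₄) * (z₂ -ᴿ z₃) * ((x₁ -ᴿ x₂) * (x₃ -ᴿ x₄))
    cross-ratio {x₁} {x₂} {x₃} {x₄} {z₁} {z₂} {z₃} {z₄} i₁ i₂ i₃ i₄ = begin
      (z₁ -ᴿ z₂) * (z₃ -ᴿ z₄) * ((x₁ -ᴿ x₄) * (x₂ -ᴿ x₃))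
        ≈⟨ *-cong (*-cong (difference i₁ i₂) (difference i₃ i₄)) ≈-refl ⟩
      scale i₁ * scale i₂ * ((x₁ -ᴿ x₂) * γ) * (scale i₃ * scale i₄ * ((x₃ -ᴿ x₄) * γ)) *
        ((x₁ -ᴿ x₄) * (x₂ -ᴿ x₃))
        ≈⟨ rearrange (scale i₁) (scale i₂) (scale i₃) (scale i₄)
             (x₁ -ᴿ x₂) (x₃ -ᴿ x₄) (x₁ -ᴿ x₄) (x₂ -ᴿ x₃) γ ⟩
      scale i₁ * scale i₄ * ((x₁ -ᴿ x₄) * γ) * (scale i₂ * scale i₃ * ((x₂ -ᴿ x₃) * γ)) *
        ((x₁ -ᴿ x₂) * (x₃ -ᴿ x₄))
        ≈⟨ *-cong (*-cong (difference i₁ i₄) (difference i₂ i₃)) ≈-refl ⟨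
      (z₁ -ᴿ z₄) * (z₂ -ᴿ z₃) * ((x₁ -ᴿ x₂) * (x₃ -ᴿ x₄))
        ∎
      where
      rearrange : ∀ r₁ r₂ r₃ r₄ a b c d g →
        r₁ * r₂ * (a * g) * (r₃ * r₄ * (b * g)) * (c * d) ≈
        r₁ * r₄ * (c * g) * (r₂ * r₃ * (d * g)) * (a * b)
      rearrange r₁ r₂ r₃ r₄ a b c d g = pointwise λ n → solve 9
        (λ r₁ r₂ r₃ r₄ a b c d g →
          r₁ :* r₂ :* (a :* g) :* (r₃ :* r₄ :* (b :* g)) :* (c :* d) :=
          r₁ :* r₄ :* (c :* g) :* (r₂ :* r₃ :* (d :* g)) :* (a :* b)) refl
        (seq r₁ n) (seq r₂ n) (seq r₃ n) (seq r₄ n)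
        (seq a n) (seq b n) (seq c n) (seq d n) (seq g n)

    -- In `difference`, the factors other than `γ` are invertible: the denominators invert the
    -- scales, and `w` inverts the difference of the `x`. Multiplying by these inverses isolates
    -- `γ`.
    z≈z′⇒γ≈0 : ∀ {x z x′ z′ w} → Image x z → Image x′ z′ → w * (x -ᴿ x′) ≈ 1ℝ →
               z -ᴿ z′ ≈ 0ℝ → γ ≈ 0ℝ
    z≈z′⇒γ≈0 {x} {z} {x′} {z′} {w} i i′ w[x-x′]≈1 z-z′≈0 = begin
      γ
        ≈⟨ (pointwise λ n → solve 1 (λ g → g := con 1ℚ :* con 1ℚ :* con 1ℚ :* g) refl (seq γ n)) ⟩
      1ℝ * 1ℝ * 1ℝ * γ
        ≈⟨ *-cong (*-cong (*-cong (denominator i) (denominator i′)) (≈-sym w[x-x′]≈1)) ≈-refl ⟩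
      scale i * d * (scale i′ * d′) * (w * (x -ᴿ x′)) * γ
        ≈⟨ rearrange (scale i) d (scale i′) d′ w (x -ᴿ x′) γ ⟩
      d * d′ * w * (scale i * scale i′ * ((x -ᴿ x′) * γ))
        ≈⟨ *-cong (≈-refl {d * d′ * w}) (difference i i′) ⟨
      d * d′ * w * (z -ᴿ z′)
        ≈⟨ *-cong (≈-refl {d * d′ * w}) z-z′≈0 ⟩
      d * d′ * w * 0ℝ
        ≈⟨ (pointwise λ n → ℚ.*-zeroʳ (seq (d * d′ * w) n)) ⟩
      0ℝ
        ∎
      where
      d d′ : ℝ
      d  = x * p + q
      d′ = x′ * p + q
      rearrange : ∀ r d r′ d′ w a g →
        r * d * (r′ * d′) * (w * a) * g ≈ d * d′ * w * (r * r′ * (a * g))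
      rearrange r d r′ d′ w a g = pointwise λ n → solve 7
        (λ r d r′ d′ w a g →
          r :* d :* (r′ :* d′) :* (w :* a) :* g := d :* d′ :* w :* (r :* r′ :* (a :* g))) refl
        (seq r n) (seq d n) (seq r′ n) (seq d′ n) (seq w n) (seq a n) (seq g n)

    γ≈0⇒z≈z′ : ∀ {x z x′ z′} → Image x z → Image x′ z′ → γ ≈ 0ℝ → z -ᴿ z′ ≈ 0ℝ
    γ≈0⇒z≈z′ {x} {z} {x′} {z′} i i′ γ≈0 = begin
      z -ᴿ z′
        ≈⟨ difference i i′ ⟩
      scale i * scale i′ * ((x -ᴿ x′) * γ)
        ≈⟨ *-cong (≈-refl {scale i * scale i′}) (*-cong (≈-refl {x -ᴿ x′}) γ≈0) ⟩
      scale i * scale i′ * ((x -ᴿ x′) * 0ℝ)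
        ≈⟨ (pointwise λ n → solve 2 (λ r a → r :* (a :* con 0ℚ) := con 0ℚ) refl
              (seq (scale i * scale i′) n) (seq (x -ᴿ x′) n)) ⟩
      0ℝ
        ∎

  ∼-injective : ∀ {h : ℝ³} {x y x′ y′ r r′ d} → 1ℝ ≈ r * d →
    (∀ i → h i ≈ r * homogeneous (x , y) i) → (∀ i → h i ≈ r′ * homogeneous (x′ , y′) i) → x ≈ x′
  ∼-injective {h} {x} {y} {x′} {y′} {r} {r′} {d} 1≈rd h≈rp h≈r′p′ = begin
    x            ≈⟨ (pointwise λ n → ℚ.*-identityʳ (seq x n)) ⟨
    x * 1ℝ       ≈⟨ *-cong (≈-refl {x}) 1≈rd ⟩
    x * (r * d)  ≈⟨ rearrange x r d ⟩
    r * x * d    ≈⟨ *-cong (≈-trans (≈-sym (h≈rp 0F)) (h≈r′p′ 0F)) ≈-refl ⟩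
    r′ * x′ * d  ≈⟨ *-cong (*-cong r′≈r ≈-refl) ≈-refl ⟩
    r * x′ * d   ≈⟨ rearrange x′ r d ⟨
    x′ * (r * d) ≈⟨ *-cong (≈-refl {x′}) 1≈rd ⟨
    x′ * 1ℝ      ≈⟨ (pointwise λ n → ℚ.*-identityʳ (seq x′ n)) ⟩
    x′           ∎
    where
    rearrange : ∀ x r d → x * (r * d) ≈ r * x * d
    rearrange x r d = pointwise λ n → solve 3 (λ x r d → x :* (r :* d) := r :* x :* d) refl
      (seq x n) (seq r n) (seq d n)
    -- The last homogeneous coordinate of a finite point is 1, so coordinate `2F` of `h` equals both
    -- scalars.
    r′≈r : r′ ≈ r
    r′≈r = begin
      r′       ≈⟨ (pointwise λ n → ℚ.*-identityʳ (seq r′ n)) ⟨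
      r′ * 1ℝ  ≈⟨ h≈r′p′ 2F ⟨
      h 2F     ≈⟨ h≈rp 2F ⟩
      r * 1ℝ   ≈⟨ (pointwise λ n → ℚ.*-identityʳ (seq r n)) ⟩
      r        ∎

-- Cross-ratios of integers

fromℤ-+ : ∀ a b → fromℤ (a ℤ.+ b) ≡ fromℤ a ℚ.+ fromℤ b
fromℤ-+ a b = ℚ.toℚᵘ-injective (ℚᵘ.≃-sym (ℚᵘ.≃-trans (ℚ.toℚᵘ-homo-+ (fromℤ a) (fromℤ b))
  (ℚᵘ.*≡* (cong (ℤ._* + 1) (cong₂ ℤ._+_ (ℤ.*-identityʳ a) (ℤ.*-identityʳ b))))))

fromℤ-* : ∀ a b → fromℤ (a ℤ.* b) ≡ fromℤ a ℚ.* fromℤ b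
fromℤ-* a b = ℚ.toℚᵘ-injective (ℚᵘ.≃-sym (ℚ.toℚᵘ-homo-* (fromℤ a) (fromℤ b)))

fromℤ-pos-* : ∀ m n → fromℤ (+ (m ℕ.* n)) ≡ fromℤ (+ m) ℚ.* fromℤ (+ n)
fromℤ-pos-* m n = trans (cong fromℤ (ℤ.pos-* m n)) (fromℤ-* (+ m) (+ n))

fromℤ-neg : ∀ a → fromℤ (ℤ.- a) ≡ ℚ.- 1ℚ ℚ.* fromℤ a
fromℤ-neg a = trans (cong fromℤ (sym (ℤ.-1*i≡-i a))) (fromℤ-* (ℤ.- + 1) a)

fromℤ-injective : ∀ {a b} → fromℤ a ≡ fromℤ b → a ≡ b
fromℤ-injective = cong ℚ.↥_

fromℤ-mono-< : ∀ {a b} → a ℤ.< b → fromℤ a ℚ.< fromℤ b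
fromℤ-mono-< {a} {b} a<b = ℚ.*<* (subst₂ ℤ._<_ (sym (ℤ.*-identityʳ a)) (sym (ℤ.*-identityʳ b)) a<b)

fromℤ-cancel-< : ∀ {a b} → fromℤ a ℚ.< fromℤ b → a ℤ.< b
fromℤ-cancel-< {a} {b} (ℚ.*<* a<b) = subst₂ ℤ._<_ (ℤ.*-identityʳ a) (ℤ.*-identityʳ b) a<b

fromℚ-injective : ∀ {p q} → fromℚ p ≈ fromℚ q → p ≡ q
fromℚ-injective {p} {q} p≈q with p ℚ.≟ q
... | yes p≡q = p≡q
... | no p≢q = let N , near = close p≈q ℚ.∣ p ℚ.- q ∣ 0<∣p-q∣ in
    contradiction (near N ℕ.≤-refl) (ℚ.<-irrefl refl)
  where
  0<∣p-q∣ : 0ℚ ℚ.< ℚ.∣ p ℚ.- q ∣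
  0<∣p-q∣ = ℚ.≰⇒> λ ∣p-q∣≤0 → p≢q (x∙y⁻¹≈ε⇒x≈y p q
    (ℚ.∣p∣≡0⇒p≡0 (p ℚ.- q) (ℚ.≤-antisym ∣p-q∣≤0 (ℚ.0≤∣p∣ (p ℚ.- q)))))
    where open import Algebra.Properties.Group ℚ.+-0-group using (x∙y⁻¹≈ε⇒x≈y)

fromℕ-injective : ∀ {m n} → fromℕ m ≈ fromℕ n → m ≡ n
fromℕ-injective m≈n = ℤ.+-injective (fromℤ-injective (fromℚ-injective m≈n))

fromℕ-diff : ∀ m n → fromℕ m -ᴿ fromℕ n ≈ fromℚ (fromℤ (m ⊖ n))
fromℕ-diff m n = pointwise λ _ → begin
  fromℤ (+ m) ℚ.+ ℚ.- 1ℚ ℚ.* fromℤ (+ n)  ≡⟨ cong (fromℤ (+ m) ℚ.+_) (fromℤ-neg (+ n)) ⟨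
  fromℤ (+ m) ℚ.+ fromℤ (ℤ.- + n)         ≡⟨ fromℤ-+ (+ m) (ℤ.- + n) ⟨
  fromℤ (+ m ℤ.- + n)                     ≡⟨ cong fromℤ (ℤ.[+m]-[+n]≡m⊖n m n) ⟩
  fromℤ (m ⊖ n)                           ∎
  where open ≡-Reasoning

∣⊖∣ : ∀ m n → ℤ.∣ m ⊖ n ∣ ≡ ∣ m - n ∣
∣⊖∣ m n with ℕ.≤-total m n
... | inj₁ m≤n = trans (ℤ.∣⊖∣-≤ m≤n) (sym (ℕ.m≤n⇒∣m-n∣≡n∸m m≤n))
... | inj₂ n≤m = trans (ℤ.∣m⊖n∣≡∣n⊖m∣ m n) (trans (ℤ.∣⊖∣-≤ n≤m) (sym (ℕ.m≤n⇒∣n-m∣≡n∸m n≤m)))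

fromℤ-product : ∀ a b c d → fromℚ (fromℤ a) * fromℚ (fromℤ b) * (fromℚ (fromℤ c) * fromℚ (fromℤ d))
                 ≈ fromℚ (fromℤ (a ℤ.* b ℤ.* (c ℤ.* d)))
fromℤ-product a b c d = pointwise λ _ → sym (trans (fromℤ-* (a ℤ.* b) (c ℤ.* d))
  (cong₂ ℚ._*_ (fromℤ-* a b) (fromℤ-* c d)))

∣∣-product : ∀ m m′ n n′ o o′ k k′ → ℤ.∣ (m ⊖ m′) ℤ.* (n ⊖ n′) ℤ.* ((o ⊖ o′) ℤ.* (k ⊖ k′)) ∣
                              ≡ ∣ m - m′ ∣ ℕ.* ∣ n - n′ ∣ ℕ.* (∣ o - o′ ∣ ℕ.* ∣ k - k′ ∣)
∣∣-product m m′ n n′ o o′ k k′ = trans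
  (ℤ.∣i*j∣≡∣i∣*∣j∣ ((m ⊖ m′) ℤ.* (n ⊖ n′)) ((o ⊖ o′) ℤ.* (k ⊖ k′)))
  (cong₂ ℕ._*_
    (trans (ℤ.∣i*j∣≡∣i∣*∣j∣ (m ⊖ m′) (n ⊖ n′)) (cong₂ ℕ._*_ (∣⊖∣ m m′) (∣⊖∣ n n′)))
    (trans (ℤ.∣i*j∣≡∣i∣*∣j∣ (o ⊖ o′) (k ⊖ k′)) (cong₂ ℕ._*_ (∣⊖∣ o o′) (∣⊖∣ k k′))))

diff-product : ∀ m m′ n n′ o o′ k k′ →
  (fromℕ m -ᴿ fromℕ m′) * (fromℕ n -ᴿ fromℕ n′) * ((fromℕ o -ᴿ fromℕ o′) * (fromℕ k -ᴿ fromℕ k′))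
  ≈ fromℚ (fromℤ ((m ⊖ m′) ℤ.* (n ⊖ n′) ℤ.* ((o ⊖ o′) ℤ.* (k ⊖ k′))))
diff-product m m′ n n′ o o′ k k′ = ≈-trans
  (*-cong (*-cong (fromℕ-diff m m′) (fromℕ-diff n n′)) (*-cong (fromℕ-diff o o′) (fromℕ-diff k k′)))
  (fromℤ-product (m ⊖ m′) (n ⊖ n′) (o ⊖ o′) (k ⊖ k′))

module _ (u v p q : ℝ) where
  open Fractional u v p q

  -- Both sides of the real identity are constant sequences of integers, so it descends to the
  -- integers. Absolute values then discard the signs, since the order of the `z` is unknown.
  ∣cross-ratio∣ : ∀ {x₁ x₂ x₃ x₄ z₁ z₂ z₃ z₄} →
    Image (fromℕ x₁) (fromℕ z₁) → Image (fromℕ x₂) (fromℕ z₂) →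
    Image (fromℕ x₃) (fromℕ z₃) → Image (fromℕ x₄) (fromℕ z₄) →
    ∣ z₁ - z₂ ∣ ℕ.* ∣ z₃ - z₄ ∣ ℕ.* (∣ x₁ - x₄ ∣ ℕ.* ∣ x₂ - x₃ ∣) ≡
    ∣ z₁ - z₄ ∣ ℕ.* ∣ z₂ - z₃ ∣ ℕ.* (∣ x₁ - x₂ ∣ ℕ.* ∣ x₃ - x₄ ∣)
  ∣cross-ratio∣ {x₁} {x₂} {x₃} {x₄} {z₁} {z₂} {z₃} {z₄} i₁ i₂ i₃ i₄ = begin
    ∣ z₁ - z₂ ∣ ℕ.* ∣ z₃ - z₄ ∣ ℕ.* (∣ x₁ - x₄ ∣ ℕ.* ∣ x₂ - x₃ ∣)
      ≡⟨ ∣∣-product z₁ z₂ z₃ z₄ x₁ x₄ x₂ x₃ ⟨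
    ℤ.∣ (z₁ ⊖ z₂) ℤ.* (z₃ ⊖ z₄) ℤ.* ((x₁ ⊖ x₄) ℤ.* (x₂ ⊖ x₃)) ∣
      ≡⟨ cong ℤ.∣_∣ (fromℤ-injective (fromℚ-injective
           (≈-trans (≈-sym (diff-product z₁ z₂ z₃ z₄ x₁ x₄ x₂ x₃))
           (≈-trans (cross-ratio i₁ i₂ i₃ i₄)
                    (diff-product z₁ z₄ z₂ z₃ x₁ x₂ x₃ x₄))))) ⟩
    ℤ.∣ (z₁ ⊖ z₄) ℤ.* (z₂ ⊖ z₃) ℤ.* ((x₁ ⊖ x₂) ℤ.* (x₃ ⊖ x₄)) ∣
      ≡⟨ ∣∣-product z₁ z₄ z₂ z₃ x₁ x₂ x₃ x₄ ⟩
    ∣ z₁ - z₄ ∣ ℕ.* ∣ z₂ - z₃ ∣ ℕ.* (∣ x₁ - x₂ ∣ ℕ.* ∣ x₃ - x₄ ∣)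
      ∎
    where open ≡-Reasoning

  diff-inverse : ∀ {m n} → m ≢ n → ∃[ w ] w * (fromℕ m -ᴿ fromℕ n) ≈ 1ℝ
  diff-inverse {m} {n} m≢n = fromℚ (ℚ.1/ d) ,
    ≈-trans (*-cong (≈-refl {fromℚ (ℚ.1/ d)}) (fromℕ-diff m n)) (pointwise λ _ → ℚ.*-inverseˡ d)
    where
    d : ℚ
    d = fromℤ (m ⊖ n)
    instance
      d-nonZero : ℚ.NonZero d
      d-nonZero = ℚ.≢-nonZero λ d≡0 → m≢n (ℕ.∣m-n∣≡0⇒m≡n
        (trans (sym (∣⊖∣ m n)) (cong ℤ.∣_∣ (fromℤ-injective {m ⊖ n} {+ 0} d≡0))))

  -- A fractional linear map that identifies two distinct arguments has zero determinant, hence is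
  -- constant. One pair with different images therefore makes the map injective on the others.
  images-distinct : ∀ {x z x′ z′ x″ z″ x‴ z‴} →
    Image (fromℕ x) (fromℕ z) → Image (fromℕ x′) (fromℕ z′) →
    Image (fromℕ x″) (fromℕ z″) → Image (fromℕ x‴) (fromℕ z‴) →
    x″ ≢ x‴ → z ≢ z′ → z″ ≢ z‴
  images-distinct {z = z} {z′ = z′} {x″} {z″} {x‴} {z‴} i i′ i″ i‴ x″≢x‴ z≢z′ refl =
    z≢z′ (fromℕ-injective (≈-trans (pointwise λ _ → z≡[z-z′]+z′)
      (≈-trans (+-cong (γ≈0⇒z≈z′ i i′ γ≈0) (≈-refl {fromℕ z′})) (pointwise λ _ → ℚ.+-identityˡ (fromℤ (+ z′))))))
    where
    γ≈0 : γ ≈ 0ℝ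
    γ≈0 = z≈z′⇒γ≈0 {w = proj₁ (diff-inverse x″≢x‴)} i″ i‴ (proj₂ (diff-inverse x″≢x‴))
      (≈-trans (fromℕ-diff z″ z″) (pointwise λ _ → cong fromℤ (ℤ.n⊖n≡0 z″)))
    z≡[z-z′]+z′ : fromℤ (+ z) ≡ fromℤ (+ z) ℚ.+ ℚ.- 1ℚ ℚ.* fromℤ (+ z′) ℚ.+ fromℤ (+ z′)
    z≡[z-z′]+z′ = solve 2 (λ a b → a := a :+ con (ℚ.- 1ℚ) :* b :+ b) refl (fromℤ (+ z)) (fromℤ (+ z′))
      where
      open +-*-Solver

-- Distinct naturals differ by at least 1, so the `z` factor on the left of the identity is at least
-- 1, while the one on the right is at most `m` squared. The gap hypothesis trades `X₂₃` for `D`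
-- times `X₁₂`, and `X₃₄` is at most `X₁₄`; cancelling `X₁₂` and `X₁₄` leaves the bound.
cross-ratio-bound : ∀ {D m x₁ x₂ x₃ x₄ z₁ z₂ z₃ z₄} →
  x₁ ℕ.< x₂ → x₂ ℕ.≤ x₃ → x₃ ℕ.≤ x₄ → D ℕ.* ∣ x₁ - x₂ ∣ ℕ.≤ ∣ x₂ - x₃ ∣ →
  z₁ ≢ z₂ → z₃ ≢ z₄ → ∣ z₁ - z₄ ∣ ℕ.≤ m → ∣ z₂ - z₃ ∣ ℕ.≤ m →
  ∣ z₁ - z₂ ∣ ℕ.* ∣ z₃ - z₄ ∣ ℕ.* (∣ x₁ - x₄ ∣ ℕ.* ∣ x₂ - x₃ ∣) ≡
  ∣ z₁ - z₄ ∣ ℕ.* ∣ z₂ - z₃ ∣ ℕ.* (∣ x₁ - x₂ ∣ ℕ.* ∣ x₃ - x₄ ∣) →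
  D ℕ.≤ m ℕ.* m
cross-ratio-bound {D} {m} {x₁} {x₂} {x₃} {x₄} {z₁} {z₂} {z₃} {z₄}
  x₁<x₂ x₂≤x₃ x₃≤x₄ gap z₁≢z₂ z₃≢z₄ z₁₄≤m z₂₃≤m eq =
  ℕ.*-cancelʳ-≤ D (m ℕ.* m) (X₁₂ ℕ.* X₁₄) (begin
    D ℕ.* (X₁₂ ℕ.* X₁₄)
      ≡⟨ ℕ.*-assoc D X₁₂ X₁₄ ⟨
    D ℕ.* X₁₂ ℕ.* X₁₄
      ≤⟨ ℕ.*-monoˡ-≤ X₁₄ gap ⟩
    X₂₃ ℕ.* X₁₄
      ≡⟨ ℕ.*-comm X₂₃ X₁₄ ⟩
    X₁₄ ℕ.* X₂₃
      ≤⟨ ℕ.m≤n*m (X₁₄ ℕ.* X₂₃) (∣ z₁ - z₂ ∣ ℕ.* ∣ z₃ - z₄ ∣) ⟩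
    ∣ z₁ - z₂ ∣ ℕ.* ∣ z₃ - z₄ ∣ ℕ.* (X₁₄ ℕ.* X₂₃)
      ≡⟨ eq ⟩
    ∣ z₁ - z₄ ∣ ℕ.* ∣ z₂ - z₃ ∣ ℕ.* (X₁₂ ℕ.* X₃₄)
      ≤⟨ ℕ.*-mono-≤ (ℕ.*-mono-≤ z₁₄≤m z₂₃≤m) (ℕ.*-monoʳ-≤ X₁₂ X₃₄≤X₁₄) ⟩
    m ℕ.* m ℕ.* (X₁₂ ℕ.* X₁₄)
      ∎)
  where
  open ℕ.≤-Reasoning
  X₁₂ X₁₄ X₂₃ X₃₄ : ℕ
  X₁₂ = ∣ x₁ - x₂ ∣
  X₁₄ = ∣ x₁ - x₄ ∣
  X₂₃ = ∣ x₂ - x₃ ∣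
  X₃₄ = ∣ x₃ - x₄ ∣
  x₁<x₃ : x₁ ℕ.< x₃
  x₁<x₃ = ℕ.<-≤-trans x₁<x₂ x₂≤x₃
  x₁<x₄ : x₁ ℕ.< x₄
  x₁<x₄ = ℕ.<-≤-trans x₁<x₃ x₃≤x₄
  X₃₄≤X₁₄ : X₃₄ ℕ.≤ X₁₄
  X₃₄≤X₁₄ = subst₂ ℕ._≤_ (sym (ℕ.m≤n⇒∣m-n∣≡n∸m x₃≤x₄)) (sym (ℕ.m≤n⇒∣m-n∣≡n∸m (ℕ.<⇒≤ x₁<x₄)))
    (ℕ.∸-monoʳ-≤ x₄ (ℕ.<⇒≤ x₁<x₃))
  distance-nonZero : ∀ {a b} → a ≢ b → NonZero ∣ a - b ∣
  distance-nonZero a≢b = ℕ.≢-nonZero λ d≡0 → a≢b (ℕ.∣m-n∣≡0⇒m≡n d≡0)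
  instance
    z-nonZero : NonZero (∣ z₁ - z₂ ∣ ℕ.* ∣ z₃ - z₄ ∣)
    z-nonZero = ℕ.m*n≢0 _ _ {{distance-nonZero z₁≢z₂}} {{distance-nonZero z₃≢z₄}}
    x-nonZero : NonZero (X₁₂ ℕ.* X₁₄)
    x-nonZero = ℕ.m*n≢0 _ _ {{distance-nonZero (ℕ.<⇒≢ x₁<x₂)}} {{distance-nonZero (ℕ.<⇒≢ x₁<x₄)}}

-- With base `D` + 1, the step from exponent `j` to `j` + 1 is already `D` times the power at `j`,
-- and that power exceeds every difference to a smaller power.
power-gap : ∀ D {i j k} → i ℕ.≤ j → j ℕ.< k →
  D ℕ.* ∣ suc D ^ i - suc D ^ j ∣ ℕ.≤ ∣ suc D ^ j - suc D ^ k ∣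
power-gap D {i} {j} {k} i≤j j<k = begin
  D ℕ.* ∣ suc D ^ i - suc D ^ j ∣     ≡⟨ cong (D ℕ.*_) (ℕ.m≤n⇒∣m-n∣≡n∸m (ℕ.^-monoʳ-≤ (suc D) i≤j)) ⟩
  D ℕ.* (suc D ^ j ℕ.∸ suc D ^ i)     ≤⟨ ℕ.*-monoʳ-≤ D (ℕ.m∸n≤m (suc D ^ j) (suc D ^ i)) ⟩
  D ℕ.* suc D ^ j                     ≡⟨ ℕ.m+n∸m≡n (suc D ^ j) (D ℕ.* suc D ^ j) ⟨
  suc D ^ suc j ℕ.∸ suc D ^ j         ≤⟨ ℕ.∸-monoˡ-≤ (suc D ^ j) (ℕ.^-monoʳ-≤ (suc D) j<k) ⟩
  suc D ^ k ℕ.∸ suc D ^ j             ≡⟨ ℕ.m≤n⇒∣m-n∣≡n∸m (ℕ.^-monoʳ-≤ (suc D) (ℕ.<⇒≤ j<k)) ⟨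
  ∣ suc D ^ j - suc D ^ k ∣           ∎
  where open ℕ.≤-Reasoning

-- Subsets of a product

∣++∣ : ∀ {m n} (p : Subset m) (q : Subset n) → ∣ p ++ q ∣ ≡ ∣ p ∣ ℕ.+ ∣ q ∣
∣++∣ []          q = refl
∣++∣ (true  ∷ p) q = cong suc (∣++∣ p q)
∣++∣ (false ∷ p) q = ∣++∣ p q

pigeonhole : ∀ {m k} b (ps : Vec (Subset k) m) → m ℕ.* b ℕ.< ∣ concat ps ∣ →
             ∃[ i ] b ℕ.< ∣ lookup ps i ∣
pigeonhole b [] ()
pigeonhole b (p ∷ ps) large with b ℕ.<? ∣ p ∣
... | yes b<∣p∣ = zero , b<∣p∣
... | no  b≮∣p∣ = let i , b<∣q∣ = rest in suc i , b<∣q∣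
  where
  rest : ∃[ i ] b ℕ.< ∣ lookup ps i ∣
  rest = pigeonhole b ps (ℕ.+-cancelˡ-< b _ _ (ℕ.<-≤-trans large
    (ℕ.≤-trans (ℕ.≤-reflexive (∣++∣ p (concat ps))) (ℕ.+-monoˡ-≤ _ (ℕ.≮⇒≥ b≮∣p∣)))))

elements : ∀ {n} (p : Subset n) → Fin ∣ p ∣ → Fin n
elements (true  ∷ p) zero    = zero
elements (true  ∷ p) (suc i) = suc (elements p i)
elements (false ∷ p) i       = suc (elements p i)

elements-∈ : ∀ {n} (p : Subset n) i → lookup p (elements p i) ≡ true
elements-∈ (true  ∷ p) zero    = refl
elements-∈ (true  ∷ p) (suc i) = elements-∈ p i
elements-∈ (false ∷ p) i       = elements-∈ p i

elements-mono-< : ∀ {n} (p : Subset n) {i j} → i Fin.< j → elements p i Fin.< elements p j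
elements-mono-< (true  ∷ p) {zero}  {suc j} _         = s≤s z≤n
elements-mono-< (true  ∷ p) {suc i} {suc j} (s≤s i<j) = s≤s (elements-mono-< p i<j)
elements-mono-< (false ∷ p)                 i<j       = s≤s (elements-mono-< p i<j)

-- `combine` lays the product out as `m` consecutive blocks of length `k`, so `group` cuts `S` into
-- its rows. Pigeonhole gives a row with more than `b` elements, and `inject≤` keeps the first `b` +
-- 1 of them in increasing order.
row-with-many : ∀ {m k} b (S : Subset (m ℕ.* k)) → m ℕ.* b ℕ.< ∣ S ∣ →
  ∃[ i ] Σ[ js ∈ (Fin (suc b) → Fin k) ]
    (∀ {a a′} → a Fin.< a′ → js a Fin.< js a′) × (∀ a → combine {m} i (js a) ∈ S)
row-with-many {m} {k} b S large with group m k S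
... | ps , refl with pigeonhole b ps large
... | i , b<∣p∣ = i , (λ a → elements (lookup ps i) (inject≤ a b<∣p∣)) ,
  (λ {a} {a′} a<a′ → elements-mono-< (lookup ps i)
    (subst₂ ℕ._<_ (sym (Fin.toℕ-inject≤ a b<∣p∣)) (sym (Fin.toℕ-inject≤ a′ b<∣p∣)) a<a′)) ,
  λ a → lookup⇒[]= _ (concat ps)
    (trans (lookup-concat ps i _) (elements-∈ (lookup ps i) (inject≤ a b<∣p∣)))

-- Grids meeting a horizontal line

distance-≤ : ∀ {z z′ k m} → z ∈[ k ] → z′ ∈[ k ] → k ℕ.≤ m → ∣ z - z′ ∣ ℕ.≤ m
distance-≤ {z} {z′} (_ , z≤k) (_ , z′≤k) k≤m =
  ℕ.≤-trans (ℕ.∣m-n∣≤m⊔n z z′) (ℕ.≤-trans (ℕ.⊔-lub z≤k z′≤k) k≤m)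

module _ {s t} (G : Grid s t) (y : ℝ) where

  private
    f = Grid.transformation G
    N = inverse f

  -- Lattice coordinate `i` of the preimage of a point at height `y`, as a function of its abscissa.
  -- Row `i` of the inverse matrix gives the numerator and row `2F` the denominator, so both
  -- coordinates share the same scale.
  module Coordinate (i : Fin 3) =
    Fractional (N i 0F) (y * N i 1F + N i 2F) (N 2F 0F) (y * N 2F 1F + N 2F 2F)

  record Preimage (x : ℕ) : Set where
    field
      {a b} : ℕ
      a∈[t] : a ∈[ t ]
      b∈[s] : b ∈[ s ]
      r     : ℝ
      f⟨ab⟩ : ∀ i → (f ⟨ latticePoint a b ⟩) i ≈ r * homogeneous (fromℕ x , y) i

    pre : ∀ i → homogeneous (latticePoint a b) i ≈ r * (fromℕ x * N i 0F + (y * N i 1F + N i 2F))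
    pre = preimage f (latticePoint a b) (fromℕ x) y r f⟨ab⟩

    imageᵃ : Coordinate.Image 0F (fromℕ x) (fromℕ a)
    imageᵃ = Fractional.image r (pre 0F) (pre 2F)

    imageᵇ : Coordinate.Image 1F (fromℕ x) (fromℕ b)
    imageᵇ = Fractional.image r (pre 1F) (pre 2F)

  open Preimage

  ∈ᴳ⇒Preimage : ∀ {x} → (fromℕ x , y) ∈ᴳ G → Preimage x
  ∈ᴳ⇒Preimage (_ , _ , a∈[t] , b∈[s] , r , _ , f⟨ab⟩) =
    record { a∈[t] = a∈[t] ; b∈[s] = b∈[s] ; r = r ; f⟨ab⟩ = f⟨ab⟩ }

  coincide : ∀ {x x′} (p : Preimage x) (p′ : Preimage x′) → a p ≡ a p′ → b p ≡ b p′ → x ≡ x′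
  coincide {x} {x′} record { f⟨ab⟩ = h ; r = r ; a∈[t] = α ; b∈[s] = β } record { f⟨ab⟩ = h′ } refl refl =
    -- The last coordinate of `pre` exhibits an inverse of the scalar `r`.
    fromℕ-injective (∼-injective (pre p 2F) h h′)
    where
    p : Preimage x
    p = record { a∈[t] = α ; b∈[s] = β ; r = r ; f⟨ab⟩ = h }

  -- The first two points are distinct, so their lattice preimages differ in at least one
  -- coordinate. That coordinate is a nonconstant fractional linear function of the abscissa, and
  -- its cross-ratio gives the bound.
  four-on-row : ∀ {D m x₁ x₂ x₃ x₄} → s ℕ.≤ m → t ℕ.≤ m →
    x₁ ℕ.< x₂ → x₂ ℕ.≤ x₃ → x₃ ℕ.< x₄ → D ℕ.* ∣ x₁ - x₂ ∣ ℕ.≤ ∣ x₂ - x₃ ∣ →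
    Preimage x₁ → Preimage x₂ → Preimage x₃ → Preimage x₄ → D ℕ.≤ m ℕ.* m
  four-on-row {D} {m} {x₁} {x₂} {x₃} {x₄} s≤m t≤m x₁<x₂ x₂≤x₃ x₃<x₄ gap p₁ p₂ p₃ p₄
    with a p₁ ℕ.≟ a p₂ | b p₁ ℕ.≟ b p₂
  ... | yes a≡ | yes b≡ = contradiction (coincide p₁ p₂ a≡ b≡) (ℕ.<⇒≢ x₁<x₂)
  ... | no a₁≢a₂ | _ = cross-ratio-bound x₁<x₂ x₂≤x₃ (ℕ.<⇒≤ x₃<x₄) gap a₁≢a₂
    (images-distinct _ _ _ _ (imageᵃ p₁) (imageᵃ p₂) (imageᵃ p₃) (imageᵃ p₄) (ℕ.<⇒≢ x₃<x₄) a₁≢a₂)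
    (distance-≤ (a∈[t] p₁) (a∈[t] p₄) t≤m) (distance-≤ (a∈[t] p₂) (a∈[t] p₃) t≤m)
    (∣cross-ratio∣ _ _ _ _ (imageᵃ p₁) (imageᵃ p₂) (imageᵃ p₃) (imageᵃ p₄))
  ... | _ | no b₁≢b₂ = cross-ratio-bound x₁<x₂ x₂≤x₃ (ℕ.<⇒≤ x₃<x₄) gap b₁≢b₂
    (images-distinct _ _ _ _ (imageᵇ p₁) (imageᵇ p₂) (imageᵇ p₃) (imageᵇ p₄) (ℕ.<⇒≢ x₃<x₄) b₁≢b₂)
    (distance-≤ (b∈[s] p₁) (b∈[s] p₄) s≤m) (distance-≤ (b∈[s] p₂) (b∈[s] p₃) s≤m)
    (∣cross-ratio∣ _ _ _ _ (imageᵇ p₁) (imageᵇ p₂) (imageᵇ p₃) (imageᵇ p₄))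

-- Passing between real and natural inequalities

archimedean : ∀ {ε} → 0ℚ ℚ.< ε → ∃[ d ] 1ℚ ℚ.≤ fromℤ (+ suc d) ℚ.* ε
-- Multiplying a positive fraction by its denominator `suc d` gives its numerator, which is at least
-- 1.
archimedean {ε@(mkℚ (+ suc p) d _)} _ = d , ℚ.toℚᵘ-cancel-≤ (ℚᵘ.≤-respʳ-≃
  (ℚᵘ.≃-sym (ℚ.toℚᵘ-homo-* (fromℤ (+ suc d)) ε))
  (ℚᵘ.*≤* (ℤ.+≤+ (begin
    suc d ℕ.+ 0 ℕ.+ 0         ≡⟨ ℕ.+-identityʳ (suc d ℕ.+ 0) ⟩
    suc d ℕ.+ 0               ≡⟨ ℕ.+-identityʳ (suc d) ⟩
    suc d                     ≤⟨ ℕ.m≤m*n (suc d) (suc p) ⟩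
    suc d ℕ.* suc p           ≡⟨ ℕ.*-identityʳ (suc d ℕ.* suc p) ⟨
    suc d ℕ.* suc p ℕ.* 1     ∎))))
  where open ℕ.≤-Reasoning
archimedean {mkℚ (+ zero)     _ _} (ℚ.*<* (ℤ.+<+ ()))
archimedean {mkℚ ℤ.-[1+ _ ]   _ _} (ℚ.*<* ())

module _ where
  open ℚ.≤-Reasoning

  -- The order needs one gap valid for a whole tail; a rational `q` between `p` and the tail of `x`
  -- provides `q` - `p`.
  <-intro : ∀ {x} {p q : ℚ} N → p ℚ.< q → (∀ n → N ℕ.≤ n → q ℚ.≤ seq x n) → fromℚ p < x
  <-intro {x} {p} {q} N p<q q≤x = q ℚ.- p ,
    subst (ℚ._< q ℚ.- p) (ℚ.+-inverseʳ p) (ℚ.+-monoˡ-< (ℚ.- p) p<q) , N ,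
    λ n N≤n → subst (ℚ._≤ seq x n) (sym (p+[q-p]≡q p q)) (q≤x n N≤n)
    where
    open +-*-Solver
    p+[q-p]≡q : ∀ p q → p ℚ.+ (q ℚ.- p) ≡ q
    p+[q-p]≡q = solve 2 (λ p q → p :+ (q :- p) := q) refl

  fromℚ-cancel-< : ∀ {p q} → fromℚ p < fromℚ q → p ℚ.< q
  fromℚ-cancel-< {p} {q} (ε , 0<ε , N , p+ε≤q) = begin-strict
    p          ≡⟨ ℚ.+-identityʳ p ⟨
    p ℚ.+ 0ℚ   <⟨ ℚ.+-monoʳ-< p 0<ε ⟩
    p ℚ.+ ε    ≤⟨ p+ε≤q N ℕ.≤-refl ⟩
    q          ∎

  -- Since `_≤_` is a negated strict inequality, the argument is by contradiction: if `suc d` times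
  -- `k` were below `M`, then `k` would be below `ε` times `M`, which bounds the tail of
  -- `c * fromℕ M` from below.
  scaled-lower-bound : ∀ {c ε} N d → (∀ n → N ℕ.≤ n → ε ℚ.≤ seq c n) → 1ℚ ℚ.≤ fromℤ (+ suc d) ℚ.* ε →
    ∀ M k → c * fromℕ M ≤ fromℕ k → M ℕ.≤ suc d ℕ.* k
  scaled-lower-bound {c} {ε} N d ε≤c 1≤dε M k cM≤k = ℕ.≮⇒≥ λ dk<M →
    cM≤k (<-intro {c * fromℕ M} {q = ε ℚ.* fromℤ (+ M)} N (ℚ.*-cancelˡ-<-nonNeg (fromℤ (+ suc d)) (begin-strict
      fromℤ (+ suc d) ℚ.* fromℤ (+ k)         ≡⟨ fromℤ-pos-* (suc d) k ⟨
      fromℤ (+ (suc d ℕ.* k))                 <⟨ fromℤ-mono-< (ℤ.+<+ dk<M) ⟩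
      fromℤ (+ M)                             ≡⟨ ℚ.*-identityˡ (fromℤ (+ M)) ⟨
      1ℚ ℚ.* fromℤ (+ M)                      ≤⟨ ℚ.*-monoʳ-≤-nonNeg (fromℤ (+ M)) 1≤dε ⟩
      fromℤ (+ suc d) ℚ.* ε ℚ.* fromℤ (+ M)   ≡⟨ ℚ.*-assoc (fromℤ (+ suc d)) ε (fromℤ (+ M)) ⟩
      fromℤ (+ suc d) ℚ.* (ε ℚ.* fromℤ (+ M)) ∎))
      (λ n N≤n → ℚ.*-monoʳ-≤-nonNeg (fromℤ (+ M)) (ε≤c n N≤n)))

  reciprocal-< : ∀ K M k → fromℕ k < fromℚ (ℚ.1/ fromℤ (+ suc K)) * fromℕ M → suc K ℕ.* k ℕ.< M
  reciprocal-< K M k k<M/K = ℤ.drop‿+<+ (fromℤ-cancel-< (begin-strict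
    fromℤ (+ (suc K ℕ.* k))                          ≡⟨ fromℤ-pos-* (suc K) k ⟩
    q ℚ.* fromℤ (+ k)                                <⟨ ℚ.*-monoʳ-<-pos q (fromℚ-cancel-< {q = ℚ.1/ q ℚ.* fromℤ (+ M)} k<M/K) ⟩
    q ℚ.* (ℚ.1/ q ℚ.* fromℤ (+ M))                   ≡⟨ ℚ.*-assoc q (ℚ.1/ q) (fromℤ (+ M)) ⟨
    q ℚ.* ℚ.1/ q ℚ.* fromℤ (+ M)                     ≡⟨ cong (ℚ._* fromℤ (+ M)) (ℚ.*-inverseʳ q) ⟩
    1ℚ ℚ.* fromℤ (+ M)                               ≡⟨ ℚ.*-identityˡ (fromℤ (+ M)) ⟩
    fromℤ (+ M)                                      ∎))
    where
    q : ℚ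
    q = fromℤ (+ suc K)

-- The point set and its covering lines

row,column : ∀ n → Fin (n ^ 2) → Fin n × Fin (n ℕ.* 1)
row,column n = remQuot {n} (n ℕ.* 1)

-- The successor of the `D` used in `power-gap`, here the square of `n ^ 3`, to be compared with the
-- square of the grid size.
base : ℕ → ℕ
base n = suc (n ^ 3 ℕ.* n ^ 3)

-- The column index lives in `Fin (n ℕ.* 1)` because `n ^ 2` unfolds to `n ℕ.* (n ℕ.* 1)`.
spaced-point : ∀ n → Fin n × Fin (n ℕ.* 1) → ℝ²
spaced-point n (i , j) = fromℕ (base n ^ toℕ j) , fromℕ (toℕ i)

^-injective : ∀ b {i j} → 1 ℕ.< b → b ^ i ≡ b ^ j → i ≡ j
^-injective b {i} {j} 1<b eq with ℕ.<-cmp i j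
... | tri< i<j _ _ = contradiction eq (ℕ.<⇒≢ (ℕ.^-monoʳ-< b 1<b i<j))
... | tri≈ _ i≡j _ = i≡j
... | tri> _ _ j<i = contradiction (sym eq) (ℕ.<⇒≢ (ℕ.^-monoʳ-< b 1<b j<i))

1<base : ∀ n → .{{NonZero n}} → 1 ℕ.< base n
1<base n = s≤s (ℕ.>-nonZero⁻¹ _ {{ℕ.m*n≢0 (n ^ 3) (n ^ 3) {{ℕ.m^n≢0 n 3}} {{ℕ.m^n≢0 n 3}}}})

points : (n : ℕ) → .{{_ : NonZero n}} → PointSet (n ^ 2)
points n = record
  { point    = λ k → spaced-point n (row,column n k)
  ; distinct = λ {k} {k′} (x≈x′ , y≈y′) → begin
      k                                             ≡⟨ Fin.combine-remQuot {n} (n ℕ.* 1) k ⟨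
      uncurry combine (row,column n k)              ≡⟨ cong₂ combine
        (Fin.toℕ-injective (fromℕ-injective y≈y′))
        (Fin.toℕ-injective (^-injective (base n) (1<base n) (fromℕ-injective x≈x′))) ⟩
      uncurry combine (row,column n k′)             ≡⟨ Fin.combine-remQuot {n} (n ℕ.* 1) k′ ⟩
      k′                                            ∎
  }
  where open ≡-Reasoning

horizontal : ℕ → Line
horizontal y = record { a = 0ℝ ; b = 1ℝ ; c = fromℕ y
  ; nondegenerate = λ (_ , 1≈0) → contradiction (fromℕ-injective {1} {0} 1≈0) λ () }

0x+1y≈y : ∀ x y → 0ℝ * x + 1ℝ * y ≈ y
0x+1y≈y x y = pointwise λ n → solve 2 (λ x y → con 0ℚ :* x :+ con 1ℚ :* y := y) refl (seq x n) (seq y n)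
  where
  open +-*-Solver

rows : ∀ n → LineSet n
rows n = record
  { line     = λ i → horizontal (toℕ i)
  -- The test point with coordinates 0 and `toℕ i` lies on line `i`; on line `i′` its height would
  -- have to be `toℕ i′`.
  ; distinct = λ {i} {i′} (i⊆i′ , _) → Fin.toℕ-injective (fromℕ-injective
      (≈-trans (≈-sym (0x+1y≈y 0ℝ (fromℕ (toℕ i)))) (i⊆i′ {0ℝ , fromℕ (toℕ i)} (0x+1y≈y 0ℝ (fromℕ (toℕ i))))))
  }

rows-cover : ∀ n → .{{_ : NonZero n}} → rows n Covers points n
rows-cover n k = proj₁ (row,column n k) , 0x+1y≈y (proj₁ (point (points n) k)) (proj₂ (point (points n) k))

-- Lower bounds on the grid size

large-subset-grid : ∀ n → .{{_ : NonZero n}} → (S : Subset (n ^ 2)) → n ℕ.* 3 ℕ.< ∣ S ∣ →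
  ∀ s t → .{{_ : NonZero s}} → .{{_ : NonZero t}} → (G : Grid s t) → points n ↾ S ⊆ᴳ G →
  n ^ 3 ℕ.* n ^ 3 ℕ.≤ (s ℕ.* t) ℕ.* (s ℕ.* t)
large-subset-grid n S large s t G S⊆G =
  -- More than 3 points per row on average put at least four points on some row.
  let i , js , js-mono , js∈S = row-with-many 3 S large
      x = λ a → base n ^ toℕ (js a)
      pre = λ a → ∈ᴳ⇒Preimage G (fromℕ (toℕ i)) (subst (λ ij → spaced-point n ij ∈ᴳ G)
                    (Fin.remQuot-combine i (js a)) (S⊆G (combine i (js a)) (js∈S a)))
      x-mono = λ {a} {a′} (a<a′ : a Fin.< a′) → ℕ.^-monoʳ-< (base n) (1<base n) (js-mono a<a′)
      0<1 = s≤s z≤n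
      1<2 = s≤s (s≤s z≤n)
      2<3 = s≤s (s≤s (s≤s z≤n))
  -- Both `s` and `t` are at most their product, so `m` is taken to be `s ℕ.* t` whichever
  -- coordinate separates the points.
  in four-on-row G (fromℕ (toℕ i)) (ℕ.m≤m*n s t) (ℕ.m≤n*m t s)
       (x-mono {0F} {1F} 0<1) (ℕ.<⇒≤ (x-mono {1F} {2F} 1<2)) (x-mono {2F} {3F} 2<3)
       (power-gap (n ^ 3 ℕ.* n ^ 3) (ℕ.<⇒≤ (js-mono {0F} {1F} 0<1)) (js-mono {1F} {2F} 1<2))
       (pre 0F) (pre 1F) (pre 2F) (pre 3F)

-- A subset with more than 3`n` points forces a grid of size at least `n ^ 3`, by comparing squares.
-- Otherwise density bounds `n` by `suc d ℕ.* 3`, and a nonempty grid is large enough once the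
-- constant is the cube of that bound.
grid-size : ∀ n → .{{_ : NonZero n}} → (S : Subset (n ^ 2)) → ∀ d → n ^ 2 ℕ.≤ suc d ℕ.* ∣ S ∣ →
  ∀ s t → .{{_ : NonZero s}} → .{{_ : NonZero t}} → (G : Grid s t) → points n ↾ S ⊆ᴳ G →
  n ^ 3 ℕ.≤ (suc d ℕ.* 3) ^ 3 ℕ.* (s ℕ.* t)
grid-size n S d n²≤d∣S∣ s t G S⊆G with n ℕ.* 3 ℕ.<? ∣ S ∣
... | yes large = ℕ.≤-trans
  (ℕ.≮⇒≥ λ st<n³ → ℕ.<⇒≱ (ℕ.*-mono-< st<n³ st<n³) (large-subset-grid n S large s t G S⊆G))
  (ℕ.m≤n*m (s ℕ.* t) ((suc d ℕ.* 3) ^ 3) {{ℕ.m^n≢0 (suc d ℕ.* 3) 3}})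
... | no small = ℕ.≤-trans (ℕ.^-monoˡ-≤ 3 n≤3d)
  (ℕ.m≤m*n ((suc d ℕ.* 3) ^ 3) (s ℕ.* t) {{ℕ.m*n≢0 s t}})
  where
  open ℕ.≤-Reasoning
  n≤3d : n ℕ.≤ suc d ℕ.* 3
  n≤3d = ℕ.*-cancelˡ-≤ n (begin
    n ℕ.* n               ≡⟨ cong (n ℕ.*_) (ℕ.*-identityʳ n) ⟨
    n ^ 2                 ≤⟨ n²≤d∣S∣ ⟩
    suc d ℕ.* ∣ S ∣       ≤⟨ ℕ.*-monoʳ-≤ (suc d) (ℕ.≮⇒≥ small) ⟩
    suc d ℕ.* (n ℕ.* 3)   ≡⟨ ℕ.*-assoc (suc d) n 3 ⟨
    suc d ℕ.* n ℕ.* 3     ≡⟨ cong (ℕ._* 3) (ℕ.*-comm (suc d) n) ⟩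
    n ℕ.* suc d ℕ.* 3     ≡⟨ ℕ.*-assoc n (suc d) 3 ⟩
    n ℕ.* (suc d ℕ.* 3)   ∎)

theorem4 : Σ[ P ∈ ((n : ℕ) → .{{_ : NonZero n}} → PointSet (n ^ 2)) ]
    ((n : ℕ) → .{{_ : NonZero n}} → Σ[ L ∈ LineSet n ] L Covers P n)
    × ((c : ℝ) → 0ℝ < c →
    Σ[ c′ ∈ ℝ ] 0ℝ < c′ ×
    ((n : ℕ) → .{{_ : NonZero n}} → (S : Subset (n ^ 2)) →
    c * fromℕ (n ^ 2) ≤ fromℕ ∣ S ∣ →
    (s t : ℕ) → .{{_ : NonZero s}} → .{{_ : NonZero t}} →
    (G : Grid s t) → P n ↾ S ⊆ᴳ G →
    c′ * fromℕ (n ^ 3) ≤ fromℕ (s ℕ.* t)))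
theorem4 = points , (λ n → rows n , rows-cover n) , λ c (ε , 0<ε , N , ε≤c) →
  let d , 1≤dε = archimedean 0<ε
      -- The constant of `grid-size`; its reciprocal serves as `c′`.
      K = (suc d ℕ.* 3) ^ 3
      ε≤c′ = λ n N≤n → subst (ℚ._≤ seq c n) (ℚ.+-identityˡ ε) (ε≤c n N≤n)
  in fromℚ (ℚ.1/ fromℤ (+ K)) , <-intro {fromℚ (ℚ.1/ fromℤ (+ K))} 0 (ℚ.positive⁻¹ (ℚ.1/ fromℤ (+ K))) (λ _ _ → ℚ.≤-refl) ,
     -- The goal is a negated strict inequality, so its negation `st<c′n³` is assumed.
     -- `reciprocal-<` expects a successor, hence the predecessor of the positive number `K`.
     λ n S dense s t G S⊆G st<c′n³ → ℕ.<⇒≱ (reciprocal-< (ℕ.pred K) (n ^ 3) (s ℕ.* t) st<c′n³)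
       (grid-size n S d (scaled-lower-bound {c} N d ε≤c′ 1≤dε (n ^ 2) ∣ S ∣ dense) s t G S⊆G)
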